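{- Any $\varepsilon$-node-differentially private algorithm to compute the weight of a minimum cut in an incremental graph sequence of length $T$ must have additive error $\Omega(W\log T)$ when the edge weights are in $\{1,\dots,W\}$ and $W$ is a publicly known parameter. This holds even with $\varepsilon=1$.
   Context: Graphs are undirected and edge-weighted. An incremental graph sequence $(G_1,\dots,G_T)$ arises from an initial (possibly non-empty) graph $G_0$ by inserting at each time $t$ a set $\partial V_t^+$ of nodes and a set $\partial E_t^+$ of edges (no deletions). Two incremental sequences are node-adjacent (event-level) if they have the same length and initial graph, and (up to exchanging them) there are a node $v^*$ and a time $t^*$ with $\partial V_t^+=\partial V_t'^+$ for $t\ne t^*$, $\partial V_{t^*}'^+\subseteq\partial V_{t^*}^+$ and $\partial V_{t^*}^+\setminus\partial V_{t^*}'^+=\{v^*\}$; moreover every edge in $\partial E_t^+$ is incident to at least one node of $\partial V_t^+$, and $\partial E_t'^+$ is the maximal subset of $\partial E_t^+$ containing no edge incident to $v^*$. The algorithm is randomized and outputs a real number after each time step, an estimate of the value for the current graph. It is $\varepsilon$-node-differentially private if $\Pr[\mathcal A(\mathcal G)\in S]\le e^\varepsilon\Pr[\mathcal A(\mathcal G')\in S]$ for all node-adjacent $\mathcal G,\mathcal G'$ and all sets $S$ of possible output sequences. The additive error at a time step is the absolute difference between the output and the true value. The weight of a (global) minimum cut is the minimum total weight of edges crossing a partition of the nodes into two non-empty parts. -}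

module Defs where

open import Algebra.Bundles using (CommutativeRing; Semiring)
import Algebra.Definitions.RawSemiring as RawSemiringDefinitions
open import Data.Bool.Base using (Bool; true; false; not)
open import Data.Fin.Base using (Fin; zero; suc; toℕ; inject₁; inject≤)
open import Data.List.Base using (List; map; sum; filterᵇ)
open import Data.List.Membership.Propositional using (_∈_; _∉_)
open import Data.List.Relation.Binary.BagAndSetEquality using (_∼[_]_; set)
open import Data.List.Relation.Binary.Subset.Propositional using (_⊆_)
open import Data.List.Relation.Unary.Unique.Propositional using (Unique)
open import Data.Nat.Base as ℕ using (ℕ; _!)
open import Data.Product.Base using (∃-syntax; _×_)
open import Data.Sum.Base using (_⊎_; inj₁; inj₂)
open import Data.Vec.Functional using (Vector)
open import Function.Bundles using (_⇔_)
open import Level using (0ℓ)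
open import Relation.Binary.Core using (Rel)
open import Relation.Binary.PropositionalEquality using (_≡_; _≢_)
open import Relation.Binary.Structures using (IsDecTotalOrder)
open import Relation.Nullary using (¬_)
open import Relation.Unary using (Pred; ∅; U; ∁; _∩_; ⋃; _≐_; Empty; Satisfiable)

-- The real numbers of classical analysis, characterised up to isomorphism
-- as the complete (hence Archimedean) ordered field.

record CompleteOrderedField : Set₁ where
  field
    commutativeRing : CommutativeRing 0ℓ 0ℓ

  open CommutativeRing commutativeRing public
  open RawSemiringDefinitions (Semiring.rawSemiring semiring) public
    using (_^_) renaming (_×_ to _·_; sum to ∑)

  infix 4 _≤_ _<_
  infix 8 _⁻¹

  field
    _≤_             : Rel Carrier 0ℓ
    isDecTotalOrder : IsDecTotalOrder _≈_ _≤_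
    0≉1             : 0# ≉ 1#
    +-monoˡ-≤       : ∀ z {x y} → x ≤ y → x + z ≤ y + z
    *-nonNegative   : ∀ {x y} → 0# ≤ x → 0# ≤ y → 0# ≤ x * y
    -- 0# ⁻¹ is unspecified.
    _⁻¹             : Carrier → Carrier
    *-inverseʳ      : ∀ {x} → x ≉ 0# → x * x ⁻¹ ≈ 1#

  open IsDecTotalOrder isDecTotalOrder public
    using (_≟_; _≤?_; total)

  _<_ : Rel Carrier 0ℓ
  x < y = x ≤ y × x ≉ y

  IsSupremum : Pred Carrier 0ℓ → Carrier → Set
  IsSupremum S s = (∀ x → S x → x ≤ s) × (∀ y → y < s → ∃[ x ] S x × y < x)

  field
    complete : ∀ (S : Pred Carrier 0ℓ) → Satisfiable S →
               (∃[ b ] ∀ x → S x → x ≤ b) → ∃[ s ] IsSupremum S s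

  fromℕ : ℕ → Carrier
  fromℕ n = n · 1#

  ∣_∣ : Carrier → Carrier
  ∣ x ∣ with total 0# x
  ... | inj₁ 0≤x = x
  ... | inj₂ x≤0 = - x

  ConvergesTo : (ℕ → Carrier) → Carrier → Set
  ConvergesTo a l =
    ∀ δ → 0# < δ → ∃[ N ] ∀ n → N ℕ.≤ n → ∣ a n - l ∣ < δ

  HasSum : (ℕ → Carrier) → Carrier → Set
  HasSum a = ConvergesTo (λ n → ∑ (λ (i : Fin n) → a (toℕ i)))

  -- IsExp x y says that y is the value of the exponential function at x.
  IsExp : Carrier → Carrier → Set
  IsExp x = HasSum (λ n → x ^ n * fromℕ (n !) ⁻¹)

module Probability (ℝ : CompleteOrderedField) where
  open CompleteOrderedField ℝ

  data Borel {n : ℕ} : Pred (Vector Carrier n) 0ℓ → Set₁ where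
    empty      : Borel ∅
    halfSpace  : ∀ i a → Borel (λ x → x i ≤ a)
    complement : ∀ {S} → Borel S → Borel (∁ S)
    union      : ∀ {S : ℕ → Pred (Vector Carrier n) 0ℓ} →
                 (∀ k → Borel (S k)) → Borel (⋃ ℕ S)
    resp       : ∀ {S S′} → S ≐ S′ → Borel S → Borel S′

  -- Pr is applied to arbitrary sets for convenience; only its values on
  -- Borel sets are constrained and meaningful.
  record ProbabilityMeasure (n : ℕ) : Set₁ where
    field
      Pr          : Pred (Vector Carrier n) 0ℓ → Carrier
      Pr-cong     : ∀ {S S′} → Borel S → S ≐ S′ → Pr S ≈ Pr S′
      nonNegative : ∀ {S} → Borel S → 0# ≤ Pr S
      normalised  : Pr U ≈ 1#
      σ-additive  : ∀ (S : ℕ → Pred (Vector Carrier n) 0ℓ) →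
                    (∀ k → Borel (S k)) →
                    (∀ j k → j ≢ k → Empty (S j ∩ S k)) →
                    HasSum (λ k → Pr (S k)) (Pr (⋃ ℕ S))

  open ProbabilityMeasure public

-- A finite undirected graph with edge weights in {1,…,W}; node names are
-- drawn from ℕ, and weight 0 means that there is no edge.

record Graph (W : ℕ) : Set where
  field
    nodes     : List ℕ
    unique    : Unique nodes
    weight    : ℕ → ℕ → ℕ
    symmetric : ∀ u v → weight u v ≡ weight v u
    loopless  : ∀ v → weight v v ≡ 0
    bounded   : ∀ u v → weight u v ℕ.≤ W
    supported : ∀ u v → weight u v ≢ 0 → u ∈ nodes × v ∈ nodes

  Edge : ℕ → ℕ → ℕ → Set
  Edge u v w = weight u v ≡ w × w ≢ 0

open Graph public

module _ {W : ℕ} where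

  infix 4 _≅_ _⊑_

  -- Equality of labelled graphs; the order of the node list is immaterial.
  _≅_ : Graph W → Graph W → Set
  G ≅ H = (nodes G ∼[ set ] nodes H) × (∀ u v → weight G u v ≡ weight H u v)

  _⊑_ : Graph W → Graph W → Set
  G ⊑ H = (nodes G ⊆ nodes H) × (∀ u v w → Edge G u v w → Edge H u v w)

  -- S stands for the partition of the nodes into those where S is true and
  -- those where S is false.
  IsCut : Graph W → (ℕ → Bool) → Set
  IsCut G S = (∃[ u ] u ∈ nodes G × S u ≡ true)
            × (∃[ v ] v ∈ nodes G × S v ≡ false)

  cutWeight : Graph W → (ℕ → Bool) → ℕ
  cutWeight G S =
    sum (map (λ u → sum (map (weight G u) (filterᵇ (λ v → not (S v)) (nodes G))))
             (filterᵇ S (nodes G)))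

  -- No m satisfies this when G has fewer than two nodes.
  IsMinCutWeight : Graph W → ℕ → Set
  IsMinCutWeight G m = (∃[ S ] IsCut G S × cutWeight G S ≡ m)
                     × (∀ S → IsCut G S → m ℕ.≤ cutWeight G S)

-- graph zero is the initial graph G₀, and time step t : Fin T leads from
-- graph (inject₁ t) to graph (suc t).

record IncrementalSequence (W T : ℕ) : Set where
  field
    graph       : Fin (ℕ.suc T) → Graph W
    incremental : ∀ t → graph (inject₁ t) ⊑ graph (suc t)

  NewNode : Fin T → ℕ → Set
  NewNode t v = v ∈ nodes (graph (suc t)) × v ∉ nodes (graph (inject₁ t))

  NewEdge : Fin T → ℕ → ℕ → ℕ → Set
  NewEdge t u v w = Edge (graph (suc t)) u v w × ¬ Edge (graph (inject₁ t)) u v w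

open IncrementalSequence public

module _ {W T : ℕ} where

  -- 𝒢 is the sequence in which v* is inserted at time t*.
  record AdjacentVia (𝒢 𝒢′ : IncrementalSequence W T) (v* : ℕ) (t* : Fin T) : Set where
    field
      sameInitial : graph 𝒢 zero ≅ graph 𝒢′ zero
      nodes-≢     : ∀ t → t ≢ t* → ∀ v → NewNode 𝒢 t v ⇔ NewNode 𝒢′ t v
      nodes-⊆     : ∀ v → NewNode 𝒢′ t* v → NewNode 𝒢 t* v
      nodes-∖     : ∀ v → (NewNode 𝒢 t* v × ¬ NewNode 𝒢′ t* v) ⇔ (v ≡ v*)
      incident    : ∀ t u v w → NewEdge 𝒢 t u v w → NewNode 𝒢 t u ⊎ NewNode 𝒢 t v
      edges       : ∀ t u v w →
                    NewEdge 𝒢′ t u v w ⇔ (NewEdge 𝒢 t u v w × u ≢ v* × v ≢ v*)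

  NodeAdjacent : Rel (IncrementalSequence W T) 0ℓ
  NodeAdjacent 𝒢 𝒢′ =
    ∃[ v* ] ∃[ t* ] (AdjacentVia 𝒢 𝒢′ v* t* ⊎ AdjacentVia 𝒢′ 𝒢 v* t*)

module Privacy (ℝ : CompleteOrderedField) where
  open CompleteOrderedField ℝ
  open Probability ℝ

  -- A randomised algorithm with real outputs after each of T time steps,
  -- given by the distribution of its output sequence on each input.  By
  -- `online`, the first t outputs depend only on the input up to time t (and,
  -- taking t = T, not on the lists representing the node sets).
  record Algorithm (W T : ℕ) : Set₁ where
    field
      output : IncrementalSequence W T → ProbabilityMeasure T
      online : ∀ 𝒢 𝒢′ t (t≤T : t ℕ.≤ T) →
               (∀ s → toℕ s ℕ.≤ t → graph 𝒢 s ≅ graph 𝒢′ s) →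
               ∀ (S : Pred (Vector Carrier t) 0ℓ) → Borel S →
               let prefix = λ x → S (λ i → x (inject≤ i t≤T)) in
               Pr (output 𝒢) prefix ≈ Pr (output 𝒢′) prefix

  open Algorithm public

  _-NodeDifferentiallyPrivate_ : ∀ {W T} → Carrier → Algorithm W T → Set₁
  ε -NodeDifferentiallyPrivate A =
    ∃[ e^ε ] IsExp ε e^ε ×
      (∀ 𝒢 𝒢′ → NodeAdjacent 𝒢 𝒢′ → ∀ S → Borel S →
       Pr (output A 𝒢) S ≤ e^ε * Pr (output A 𝒢′) S)

  -- The output sequences that, as estimates of the minimum cut weight, have
  -- additive error at least α at some time step.
  ErrorAtLeast : ∀ {W T} → IncrementalSequence W T → Carrier → Pred (Vector Carrier T) 0ℓ
  ErrorAtLeast 𝒢 α x =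
    ∃[ t ] ∃[ m ] IsMinCutWeight (graph 𝒢 (suc t)) m × α ≤ ∣ x t - fromℕ m ∣

{-# OPTIONS --safe #-}

-- A packing argument.  Start from the clique on two nodes with all weights W,
-- whose minimum cut is W, and for each time t consider the input in which d
-- further nodes, joined to everything, arrive at time t, raising the minimum
-- cut to (d + 1)W.  If 2α ≤ dW, no output sequence is within α on two of these
-- T inputs, so the T events "accurate on input t" are disjoint.  If each has
-- probability at least 1 - γ on its own input, then it has probability at least
-- e^(-εd) (1 - γ) on the input that never changes, which is d insertions away.
-- Hence T (1 - γ) ≤ e^(εd), which fails for d a small multiple of log T.

module Submission where

open import Defs
import Algebra.Properties.Ring
import Algebra.Properties.Semiring.Mult
open import Data.Bool.Base using (Bool; true; false; not; T; if_then_else_)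
open import Data.Empty using (⊥-elim)
open import Data.Fin.Base using (Fin; zero; suc; toℕ; inject₁)
import Data.Fin.Properties as Fin
open import Data.List.Base using (List; []; _∷_; map; filterᵇ; length; upTo; applyUpTo)
open import Data.List.Membership.Propositional using (_∈_)
open import Data.List.Membership.Propositional.Properties using (∈-upTo⁺; ∈-upTo⁻; ∈-filter⁻)
open import Data.List.Properties using (length-upTo; map-cong-local)
open import Data.List.Relation.Unary.All using (tabulate)
open import Data.List.Relation.Unary.Any using (here; there)
import Data.List.Relation.Unary.Unique.Propositional.Properties as Unique
open import Data.Nat.Base as ℕ using (ℕ; zero; suc; z≤n; s≤s; s≤s⁻¹)
import Data.Nat.DivMod as ℕ
open import Data.Nat.ListAction using (sum)
open import Data.Nat.Logarithm using (⌊log₂_⌋; ⌊log₂⌊n/2⌋⌋≡⌊log₂n⌋∸1; ⌊log₂⌋-mono-≤; ⌊log₂[2^n]⌋≡n)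
import Data.Nat.Properties as ℕ
open import Data.Nat.Solver using (module +-*-Solver)
open import Data.Product.Base using (_×_; ∃-syntax; _,_; proj₁; proj₂)
open import Data.Sum.Base using (_⊎_; inj₁; inj₂)
open import Data.Unit.Base using (tt)
open import Data.Vec.Functional using (Vector)
open import Function.Base using (_∘_; const)
open import Function.Bundles using (_⇔_; mk⇔)
open import Level using (0ℓ)
open import Relation.Binary.Bundles using (Poset)
open import Relation.Binary.Definitions using (tri<; tri≈; tri>)
open import Relation.Binary.PropositionalEquality as ≡ using (_≡_; _≢_)
import Relation.Binary.Reasoning.PartialOrder
open import Relation.Binary.Structures using (IsDecTotalOrder)
open import Relation.Nullary using (¬_; Dec; yes; no; does; contradiction)
open import Relation.Nullary.Decidable using (¬?; _×-dec_; dec-true; dec-false; T?)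
open import Relation.Unary using (Pred; ∅; ∁; _∩_; ⋃; _≐_; Empty)
open +-*-Solver using (solve; _:*_; _:+_; _:=_; con)

-- Cliques in which every edge has weight `W`.

Linked : ℕ → ℕ → ℕ → Set
Linked n u v = u ≢ v × u ℕ.< n × v ℕ.< n

linked? : ∀ n u v → Dec (Linked n u v)
linked? n u v = ¬? (u ℕ.≟ v) ×-dec (u ℕ.<? n) ×-dec (v ℕ.<? n)

linked-sym : ∀ {n u v} → Linked n u v → Linked n v u
linked-sym (u≢v , u<n , v<n) = u≢v ∘ ≡.sym , v<n , u<n

linked-mono : ∀ {m n u v} → m ℕ.≤ n → Linked m u v → Linked n u v
linked-mono m≤n (u≢v , u<m , v<m) = u≢v , ℕ.<-≤-trans u<m m≤n , ℕ.<-≤-trans v<m m≤n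

module _ (W : ℕ) where

  cliqueWeight : ℕ → ℕ → ℕ → ℕ
  cliqueWeight n u v = if does (linked? n u v) then W else 0

  cliqueWeight-linked : ∀ {n u v} → Linked n u v → cliqueWeight n u v ≡ W
  cliqueWeight-linked {n} {u} {v} l rewrite dec-true (linked? n u v) l = ≡.refl

  cliqueWeight-unlinked : ∀ {n u v} → ¬ Linked n u v → cliqueWeight n u v ≡ 0
  cliqueWeight-unlinked {n} {u} {v} ¬l rewrite dec-false (linked? n u v) ¬l = ≡.refl

  cliqueWeight-≢0 : ∀ {n u v} → cliqueWeight n u v ≢ 0 → Linked n u v
  cliqueWeight-≢0 {n} {u} {v} w≢0 with linked? n u v
  ... | yes l = l
  ... | no ¬l = contradiction (cliqueWeight-unlinked ¬l) w≢0

  clique : ℕ → Graph W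
  clique n = record
    { nodes     = upTo n
    ; unique    = Unique.upTo⁺ n
    ; weight    = cliqueWeight n
    ; symmetric = sym-weight
    ; loopless  = λ v → cliqueWeight-unlinked {n} {v} (λ l → proj₁ l ≡.refl)
    ; bounded   = bounded-weight
    ; supported = λ u v w≢0 → let _ , u<n , v<n = cliqueWeight-≢0 {n} {u} {v} w≢0
                              in ∈-upTo⁺ u<n , ∈-upTo⁺ v<n
    }
    where
    sym-weight : ∀ u v → cliqueWeight n u v ≡ cliqueWeight n v u
    sym-weight u v with linked? n u v
    ... | yes l = ≡.trans (cliqueWeight-linked l) (≡.sym (cliqueWeight-linked (linked-sym l)))
    ... | no ¬l = ≡.trans (cliqueWeight-unlinked ¬l) (≡.sym (cliqueWeight-unlinked (¬l ∘ linked-sym)))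
    bounded-weight : ∀ u v → cliqueWeight n u v ℕ.≤ W
    bounded-weight u v with linked? n u v
    ... | yes l = ℕ.≤-reflexive (cliqueWeight-linked l)
    ... | no ¬l = ℕ.≤-trans (ℕ.≤-reflexive (cliqueWeight-unlinked ¬l)) z≤n

  -- The conjunct `w ≢ 0` is carried along because `W` may be 0, in which case the clique has no
  -- edges at all.
  cliqueEdge⇒ : ∀ {n u v w} → Edge (clique n) u v w → Linked n u v × W ≡ w × w ≢ 0
  cliqueEdge⇒ (eq , w≢0) = l , ≡.trans (≡.sym (cliqueWeight-linked l)) eq , w≢0
    where l = cliqueWeight-≢0 (w≢0 ∘ ≡.trans (≡.sym eq))

  cliqueEdge⇐ : ∀ {n u v w} → Linked n u v × W ≡ w × w ≢ 0 → Edge (clique n) u v w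
  cliqueEdge⇐ (l , eq , w≢0) = ≡.trans (cliqueWeight-linked l) eq , w≢0

  clique-mono : ∀ {m n} → m ℕ.≤ n → clique m ⊑ clique n
  clique-mono m≤n =
    (λ u∈m → ∈-upTo⁺ (ℕ.<-≤-trans (∈-upTo⁻ u∈m) m≤n)) ,
    (λ u v w e → let l , r = cliqueEdge⇒ {u = u} {v} e in cliqueEdge⇐ (linked-mono m≤n l , r))

-- Sums and lengths over the two sides of a cut.

sum-map-const : ∀ {A : Set} c (xs : List A) → sum (map (const c) xs) ≡ length xs ℕ.* c
sum-map-const c []       = ≡.refl
sum-map-const c (x ∷ xs) = ≡.cong (c ℕ.+_) (sum-map-const c xs)

sum-map-const-local : ∀ {A : Set} (f : A → ℕ) c xs → (∀ {x} → x ∈ xs → f x ≡ c) →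
                      sum (map f xs) ≡ length xs ℕ.* c
sum-map-const-local f c xs eq =
  ≡.trans (≡.cong sum (map-cong-local (tabulate eq))) (sum-map-const c xs)

length-filterᵇ-not : ∀ {A : Set} (p : A → Bool) xs →
  length (filterᵇ p xs) ℕ.+ length (filterᵇ (not ∘ p) xs) ≡ length xs
length-filterᵇ-not p []       = ≡.refl
length-filterᵇ-not p (x ∷ xs) with p x
... | true  = ≡.cong suc (length-filterᵇ-not p xs)
... | false = ≡.trans (ℕ.+-suc _ _) (≡.cong suc (length-filterᵇ-not p xs))

∈-filterᵇ⁻ : ∀ {A : Set} (p : A → Bool) {x : A} xs → x ∈ filterᵇ p xs → x ∈ xs × T (p x)
∈-filterᵇ⁻ p xs = ∈-filter⁻ (T? ∘ p) {xs = xs}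

filterᵇ-nonEmpty : ∀ {A : Set} (p : A → Bool) {x : A} {xs} → x ∈ xs → p x ≡ true →
                   1 ℕ.≤ length (filterᵇ p xs)
filterᵇ-nonEmpty p {xs = y ∷ ys} (here ≡.refl) px rewrite px = s≤s z≤n
filterᵇ-nonEmpty p {xs = y ∷ ys} (there x∈ys) px with p y
... | true  = s≤s z≤n
... | false = filterᵇ-nonEmpty p x∈ys px

filterᵇ-none : ∀ {A : Set} (p : A → Bool) (f : ℕ → A) n → (∀ i → p (f i) ≡ false) →
               filterᵇ p (applyUpTo f n) ≡ []
filterᵇ-none p f zero    none = ≡.refl
filterᵇ-none p f (suc n) none rewrite none 0 = filterᵇ-none p (f ∘ suc) n (none ∘ suc)

-- This is `(a - 1)(b - 1) ≥ 0` rearranged. With `a` and `b` the sizes of the two sides of a cut, it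
-- says that separating a single node leaves the fewest crossing pairs.
+≤1+* : ∀ {a b} → 1 ℕ.≤ a → 1 ℕ.≤ b → a ℕ.+ b ℕ.≤ suc (a ℕ.* b)
+≤1+* {suc a} {suc b} _ _ = s≤s (begin
  a ℕ.+ suc b         ≡⟨ ℕ.+-comm a (suc b) ⟩
  suc b ℕ.+ a         ≤⟨ ℕ.+-monoʳ-≤ (suc b) (ℕ.m≤m*n a (suc b)) ⟩
  suc b ℕ.+ a ℕ.* suc b ∎)
  where open ℕ.≤-Reasoning

-- Minimum cuts of cliques.

module _ (W : ℕ) where

  -- No node lies on both sides, so each pair across the cut is linked and contributes exactly `W`.
  cutWeight-clique : ∀ n S → cutWeight (clique W n) S ≡
    length (filterᵇ S (upTo n)) ℕ.* (length (filterᵇ (not ∘ S) (upTo n)) ℕ.* W)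
  cutWeight-clique n S =
    sum-map-const-local _ _ (filterᵇ S (upTo n)) λ {u} u∈ →
    sum-map-const-local _ _ (filterᵇ (not ∘ S) (upTo n)) λ {v} v∈ →
    let u∈n , Su = ∈-filterᵇ⁻ S (upTo n) u∈
        v∈n , Sv = ∈-filterᵇ⁻ (not ∘ S) (upTo n) v∈
    in cliqueWeight-linked W ((λ { ≡.refl → T-not (S u) Su Sv }) , ∈-upTo⁻ u∈n , ∈-upTo⁻ v∈n)
    where
    T-not : ∀ b → T b → ¬ T (not b)
    T-not true _ ()

  minCut-clique : ∀ n → IsMinCutWeight (clique W (2 ℕ.+ n)) (suc n ℕ.* W)
  minCut-clique n = (S₀ , ((0 , here ≡.refl , ≡.refl) , 1 , there (here ≡.refl) , ≡.refl) , attained) , lower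
    where
    N = 2 ℕ.+ n
    inside outside : (ℕ → Bool) → ℕ
    inside S  = length (filterᵇ S (upTo N))
    outside S = length (filterᵇ (not ∘ S) (upTo N))
    inside+outside : ∀ S → inside S ℕ.+ outside S ≡ N
    inside+outside S = ≡.trans (length-filterᵇ-not S (upTo N)) (length-upTo N)
    -- This cut isolates node 0.
    S₀ : ℕ → Bool
    S₀ = ℕ._≡ᵇ 0
    inside-S₀ : inside S₀ ≡ 1
    inside-S₀ = ≡.cong (suc ∘ length) (filterᵇ-none S₀ suc (suc n) (λ _ → ≡.refl))
    outside-S₀ : outside S₀ ≡ suc n
    outside-S₀ = ℕ.suc-injective
      (≡.trans (≡.cong (ℕ._+ outside S₀) (≡.sym inside-S₀)) (inside+outside S₀))
    attained : cutWeight (clique W N) S₀ ≡ suc n ℕ.* W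
    attained = ≡.trans (cutWeight-clique N S₀)
      (≡.trans (≡.cong₂ (λ a b → a ℕ.* (b ℕ.* W)) inside-S₀ outside-S₀) (ℕ.*-identityˡ _))
    lower : ∀ S → IsCut (clique W N) S → suc n ℕ.* W ℕ.≤ cutWeight (clique W N) S
    lower S ((u , u∈ , Su) , v , v∈ , Sv) = begin
      -- The sides have `2 + n` nodes together, so `+≤1+*` gives `2 + n ≤ 1 + inside * outside`; one
      -- successor cancels.
      suc n ℕ.* W                      ≤⟨ ℕ.*-monoˡ-≤ W (s≤s⁻¹ bound) ⟩
      (inside S ℕ.* outside S) ℕ.* W   ≡⟨ ℕ.*-assoc (inside S) (outside S) W ⟩
      inside S ℕ.* (outside S ℕ.* W)   ≡⟨ cutWeight-clique N S ⟨
      cutWeight (clique W N) S         ∎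
      where
      open ℕ.≤-Reasoning
      bound : N ℕ.≤ suc (inside S ℕ.* outside S)
      bound = ≡.subst (ℕ._≤ suc (inside S ℕ.* outside S)) (inside+outside S)
        (+≤1+* (filterᵇ-nonEmpty S {xs = upTo N} u∈ Su) (filterᵇ-nonEmpty (not ∘ S) {xs = upTo N} v∈ (≡.cong not Sv)))

-- Allows the existential `m` in `ErrorAtLeast` to be replaced by one fixed value per time step.
minCut-unique : ∀ {W} {G : Graph W} {m m′} → IsMinCutWeight G m → IsMinCutWeight G m′ → m ≡ m′
minCut-unique ((S , cut , eq) , min) ((S′ , cut′ , eq′) , min′) =
  ℕ.≤-antisym (ℕ.≤-trans (min S′ cut′) (ℕ.≤-reflexive eq′))
              (ℕ.≤-trans (min′ S cut) (ℕ.≤-reflexive eq))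

-- Sequences that jump from one clique to another, and their adjacency.

module _ {W T : ℕ} where

  -- A property of sequences rather than a construction, so that a constant sequence also qualifies,
  -- with `a` and `b` equal and `t*` arbitrary.
  record CliqueJump (𝒢 : IncrementalSequence W T) (t* : Fin T) (a b : ℕ) : Set where
    field
      -- Time step `t*` leads from index `t*` to index `t* + 1`, so index `t*` itself still precedes
      -- the jump.
      before : ∀ t → toℕ t ℕ.≤ toℕ t* → graph 𝒢 t ≡ clique W a
      after  : ∀ t → toℕ t* ℕ.< toℕ t → graph 𝒢 t ≡ clique W b

  module _ {𝒢 : IncrementalSequence W T} {t* a b} (jump : CliqueJump 𝒢 t* a b) where
    open CliqueJump jump

    private
      graph-before : graph 𝒢 (inject₁ t*) ≡ clique W a
      graph-before = before _ (ℕ.≤-reflexive (Fin.toℕ-inject₁ t*))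

      graph-after : graph 𝒢 (suc t*) ≡ clique W b
      graph-after = after _ ℕ.≤-refl

    -- Both ends of a step other than `t*` lie on the same side of the jump.
    jump-static : ∀ t → t ≢ t* → graph 𝒢 (inject₁ t) ≡ graph 𝒢 (suc t)
    jump-static t t≢t* with ℕ.<-cmp (toℕ t) (toℕ t*)
    ... | tri< t<t* _ _ = ≡.trans (before _ (ℕ.≤-trans (ℕ.≤-reflexive (Fin.toℕ-inject₁ t)) (ℕ.<⇒≤ t<t*)))
                                (≡.sym (before _ t<t*))
    ... | tri≈ _ t≡t* _ = contradiction (Fin.toℕ-injective t≡t*) t≢t*
    ... | tri> _ _ t*<t = ≡.trans (after _ (ℕ.<-≤-trans t*<t (ℕ.≤-reflexive (≡.sym (Fin.toℕ-inject₁ t)))))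
                                (≡.sym (after _ (ℕ.m<n⇒m<1+n t*<t)))

    noNewNode : ∀ {t v} → t ≢ t* → ¬ NewNode 𝒢 t v
    noNewNode t≢t* (v∈ , v∉) = v∉ (≡.subst (λ G → _ ∈ nodes G) (≡.sym (jump-static _ t≢t*)) v∈)

    noNewEdge : ∀ {t u v w} → t ≢ t* → ¬ NewEdge 𝒢 t u v w
    noNewEdge t≢t* (e , ¬e) = ¬e (≡.subst (λ G → Edge G _ _ _) (≡.sym (jump-static _ t≢t*)) e)

    newNode⇒ : ∀ {v} → NewNode 𝒢 t* v → a ℕ.≤ v × v ℕ.< b
    newNode⇒ (v∈ , v∉) rewrite graph-before | graph-after =
      ℕ.≮⇒≥ (v∉ ∘ ∈-upTo⁺) , ∈-upTo⁻ v∈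

    newNode⇐ : ∀ {v} → a ℕ.≤ v → v ℕ.< b → NewNode 𝒢 t* v
    newNode⇐ a≤v v<b rewrite graph-before | graph-after =
      ∈-upTo⁺ v<b , λ v∈ → ℕ.<⇒≱ (∈-upTo⁻ v∈) a≤v

    newEdge⇒ : ∀ {u v w} → NewEdge 𝒢 t* u v w → (Linked b u v × W ≡ w × w ≢ 0) × ¬ Linked a u v
    newEdge⇒ (e , ¬e) rewrite graph-before | graph-after =
      let l , r = cliqueEdge⇒ W e in (l , r) , λ l′ → ¬e (cliqueEdge⇐ W (l′ , r))

    newEdge⇐ : ∀ {u v w} → (Linked b u v × W ≡ w × w ≢ 0) × ¬ Linked a u v → NewEdge 𝒢 t* u v w
    newEdge⇐ (lr , ¬l) rewrite graph-before | graph-after =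
      cliqueEdge⇐ W lr , λ e → ¬l (proj₁ (cliqueEdge⇒ W e))

    -- An edge between two nodes below `a` was present before the jump, so a new edge has an
    -- endpoint that is at least `a`, hence new.
    jump-incident : ∀ t u v w → NewEdge 𝒢 t u v w → NewNode 𝒢 t u ⊎ NewNode 𝒢 t v
    jump-incident t u v w e with t Fin.≟ t*
    ... | no t≢t* = contradiction e (noNewEdge t≢t*)
    ... | yes ≡.refl with newEdge⇒ e
    ...   | ((u≢v , u<b , v<b) , _) , ¬l with u ℕ.<? a | v ℕ.<? a
    ...     | yes u<a | yes v<a = contradiction (u≢v , u<a , v<a) ¬l
    ...     | no u≮a  | _       = inj₁ (newNode⇐ (ℕ.≮⇒≥ u≮a) u<b)
    ...     | yes _   | no v≮a  = inj₂ (newNode⇐ (ℕ.≮⇒≥ v≮a) v<b)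

  -- The two jumps differ only in the node named `b`, the last one of the larger clique, and the
  -- smaller clique keeps exactly the edges avoiding it. The hypothesis `a ≤ b` ensures that `b`
  -- arrives at the jump instead of being there initially.
  jump-adjacent : ∀ {𝒢 𝒢′ : IncrementalSequence W T} {t* a b} → a ℕ.≤ b →
    CliqueJump 𝒢 t* a (suc b) → CliqueJump 𝒢′ t* a b → AdjacentVia 𝒢 𝒢′ b t*
  jump-adjacent {𝒢} {𝒢′} {t*} {a} {b} a≤b jump jump′ = record
    { sameInitial = initial
    ; nodes-≢     = λ t t≢t* v → mk⇔ (⊥-elim ∘ noNewNode jump t≢t*) (⊥-elim ∘ noNewNode jump′ t≢t*)
    ; nodes-⊆     = λ v new → let a≤v , v<b = newNode⇒ jump′ new
                              in newNode⇐ jump a≤v (ℕ.m<n⇒m<1+n v<b)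
    ; nodes-∖     = λ v → mk⇔
        (λ { (new , ¬new) → let a≤v , v<1+b = newNode⇒ jump new
                            in ℕ.≤-antisym (s≤s⁻¹ v<1+b) (ℕ.≮⇒≥ (¬new ∘ newNode⇐ jump′ a≤v)) })
        (λ { ≡.refl → newNode⇐ jump a≤b ℕ.≤-refl , λ new → ℕ.<-irrefl ≡.refl (proj₂ (newNode⇒ jump′ new)) })
    ; incident    = jump-incident jump
    ; edges       = same-edges
    }
    where
    initial : graph 𝒢 zero ≅ graph 𝒢′ zero
    initial rewrite CliqueJump.before jump zero z≤n | CliqueJump.before jump′ zero z≤n =
      mk⇔ (λ x → x) (λ x → x) , λ _ _ → ≡.refl
    same-edges : ∀ t u v w → NewEdge 𝒢′ t u v w ⇔ (NewEdge 𝒢 t u v w × u ≢ b × v ≢ b)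
    same-edges t u v w with t Fin.≟ t*
    ... | no t≢t* = mk⇔ (⊥-elim ∘ noNewEdge jump′ t≢t*) (⊥-elim ∘ noNewEdge jump t≢t* ∘ proj₁)
    ... | yes ≡.refl = mk⇔
      (λ e → let (l@(_ , u<b , v<b) , r) , ¬l = newEdge⇒ jump′ e
             in newEdge⇐ jump ((linked-mono (ℕ.n≤1+n b) l , r) , ¬l) , ℕ.<⇒≢ u<b , ℕ.<⇒≢ v<b)
      (λ { (e , u≢b , v≢b) →
             let ((u≢v , u<1+b , v<1+b) , r) , ¬l = newEdge⇒ jump e
             in newEdge⇐ jump′ (((u≢v , ℕ.≤∧≢⇒< (s≤s⁻¹ u<1+b) u≢b , ℕ.≤∧≢⇒< (s≤s⁻¹ v<1+b) v≢b) , r) , ¬l) })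

  stepSize : Fin T → ℕ → Fin (suc T) → ℕ
  stepSize t* j t = if does (toℕ t ℕ.≤? toℕ t*) then 2 else 2 ℕ.+ j

  stepSize-before : ∀ t* j t → toℕ t ℕ.≤ toℕ t* → stepSize t* j t ≡ 2
  stepSize-before t* j t t≤t* rewrite dec-true (toℕ t ℕ.≤? toℕ t*) t≤t* = ≡.refl

  stepSize-after : ∀ t* j t → toℕ t* ℕ.< toℕ t → stepSize t* j t ≡ 2 ℕ.+ j
  stepSize-after t* j t t*<t rewrite dec-false (toℕ t ℕ.≤? toℕ t*) (ℕ.<⇒≱ t*<t) = ≡.refl

  stepSize-mono : ∀ t* j t → stepSize t* j (inject₁ t) ℕ.≤ stepSize t* j (suc t)
  stepSize-mono t* j t with toℕ t ℕ.≤? toℕ t* | toℕ (suc t) ℕ.≤? toℕ t*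
  ... | _         | yes t<t* = ℕ.≤-reflexive
    (≡.trans (stepSize-before t* j (inject₁ t) (≡.subst (ℕ._≤ _) (≡.sym (Fin.toℕ-inject₁ t)) (ℕ.<⇒≤ t<t*)))
           (≡.sym (stepSize-before t* j (suc t) t<t*)))
  ... | yes t≤t* | no t≮t* = ≡.subst₂ ℕ._≤_
    (≡.sym (stepSize-before t* j (inject₁ t) (≡.subst (ℕ._≤ _) (≡.sym (Fin.toℕ-inject₁ t)) t≤t*)))
    (≡.sym (stepSize-after t* j (suc t) (ℕ.≰⇒> t≮t*))) (ℕ.m≤m+n 2 j)
  ... | no t≰t*  | no t≮t* = ℕ.≤-reflexive
    (≡.trans (stepSize-after t* j (inject₁ t) (≡.subst (_ ℕ.<_) (≡.sym (Fin.toℕ-inject₁ t)) (ℕ.≰⇒> t≰t*)))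
           (≡.sym (stepSize-after t* j (suc t) (ℕ.≰⇒> t≮t*))))

  constantSequence : IncrementalSequence W T
  constantSequence = record
    { graph       = λ _ → clique W 2
    ; incremental = λ _ → clique-mono W ℕ.≤-refl
    }

  -- The case j = 0 is separated so that it does not depend on t*: all the
  -- families t* , 0 … d then start at the same input.
  jumpSequence : Fin T → ℕ → IncrementalSequence W T
  jumpSequence t* zero    = constantSequence
  jumpSequence t* (suc j) = record
    { graph       = clique W ∘ stepSize t* (suc j)
    ; incremental = clique-mono W ∘ stepSize-mono t* (suc j)
    }

  jumpSequence-jump : ∀ t* j → CliqueJump (jumpSequence t* j) t* 2 (2 ℕ.+ j)
  jumpSequence-jump t* zero    = record { before = λ _ _ → ≡.refl ; after = λ _ _ → ≡.refl }
  jumpSequence-jump t* (suc j) = record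
    { before = λ t → ≡.cong (clique W) ∘ stepSize-before t* (suc j) t
    ; after  = λ t → ≡.cong (clique W) ∘ stepSize-after t* (suc j) t
    }

  jumpSequence-adjacent : ∀ t* j → NodeAdjacent (jumpSequence t* (suc j)) (jumpSequence t* j)
  jumpSequence-adjacent t* j = 2 ℕ.+ j , t* ,
    inj₁ (jump-adjacent (ℕ.m≤m+n 2 j) (jumpSequence-jump t* (suc j)) (jumpSequence-jump t* j))

  jumpSequence-before : ∀ t* j t → toℕ t ℕ.≤ toℕ t* →
    IsMinCutWeight (graph (jumpSequence t* j) t) W
  jumpSequence-before t* j t t≤t* rewrite CliqueJump.before (jumpSequence-jump t* j) t t≤t* =
    ≡.subst (IsMinCutWeight (clique W 2)) (ℕ.*-identityˡ W) (minCut-clique W 0)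

  jumpSequence-after : ∀ t* j t → toℕ t* ℕ.< toℕ t →
    IsMinCutWeight (graph (jumpSequence t* j) t) (suc j ℕ.* W)
  jumpSequence-after t* j t t*<t rewrite CliqueJump.after (jumpSequence-jump t* j) t t*<t =
    minCut-clique W j

  jumpSequence-minCut : ∀ t* j t → ∃[ m ] IsMinCutWeight (graph (jumpSequence t* j) t) m
  jumpSequence-minCut t* j t with toℕ t ℕ.≤? toℕ t*
  ... | yes t≤t* = W , jumpSequence-before t* j t t≤t*
  ... | no t≰t*  = suc j ℕ.* W , jumpSequence-after t* j t (ℕ.≰⇒> t≰t*)

-- Ordered-field arithmetic and absolute values.

module OrderedField (ℝ : CompleteOrderedField) where
  open CompleteOrderedField ℝ hiding (zero)
  open IsDecTotalOrder isDecTotalOrder public using () renaming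
    ( refl to ≤-refl; reflexive to ≤-reflexive; trans to ≤-trans; antisym to ≤-antisym
    ; isPartialOrder to ≤-isPartialOrder )
  open Algebra.Properties.Ring ring
    using (-1*x≈-x; -‿involutive; x[y-z]≈xy-xz; ⁻¹-anti-homo‿-; //-rightDividesˡ; //-rightDividesʳ)
  open Algebra.Properties.Semiring.Mult semiring using (×-homo-+; ×1-homo-*; ×-assoc-*)

  ≤-poset : Poset 0ℓ 0ℓ 0ℓ
  ≤-poset = record { isPartialOrder = ≤-isPartialOrder }

  module ≤-Reasoning = Relation.Binary.Reasoning.PartialOrder ≤-poset
  open ≤-Reasoning

  ≰⇒> : ∀ {x y} → ¬ x ≤ y → y < x
  ≰⇒> {x} {y} x≰y with total x y
  ... | inj₁ x≤y = contradiction x≤y x≰y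
  ... | inj₂ y≤x = y≤x , λ y≈x → x≰y (≤-reflexive (sym y≈x))

  <⇒≱ : ∀ {x y} → x < y → ¬ y ≤ x
  <⇒≱ (x≤y , x≉y) y≤x = x≉y (≤-antisym x≤y y≤x)

  ≮⇒≥ : ∀ {x y} → ¬ x < y → y ≤ x
  ≮⇒≥ {x} {y} x≮y with y ≤? x
  ... | yes y≤x = y≤x
  ... | no y≰x  = contradiction (≰⇒> y≰x) x≮y

  +-monoʳ-≤ : ∀ z {x y} → x ≤ y → z + x ≤ z + y
  +-monoʳ-≤ z {x} {y} x≤y = begin
    z + x ≈⟨ +-comm z x ⟩
    x + z ≤⟨ +-monoˡ-≤ z x≤y ⟩
    y + z ≈⟨ +-comm y z ⟩
    z + y ∎

  +-mono-≤ : ∀ {x y u v} → x ≤ y → u ≤ v → x + u ≤ y + v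
  +-mono-≤ {y = y} {u} x≤y u≤v = ≤-trans (+-monoˡ-≤ u x≤y) (+-monoʳ-≤ y u≤v)

  x-y≤z⇒x≤z+y : ∀ {x y z} → x - y ≤ z → x ≤ z + y
  x-y≤z⇒x≤z+y {x} {y} {z} p = begin
    x           ≈⟨ //-rightDividesˡ y x ⟨
    (x - y) + y ≤⟨ +-monoˡ-≤ y p ⟩
    z + y       ∎

  x≤z+y⇒x-y≤z : ∀ {x y z} → x ≤ z + y → x - y ≤ z
  x≤z+y⇒x-y≤z {x} {y} {z} p = begin
    x - y       ≤⟨ +-monoˡ-≤ (- y) p ⟩
    (z + y) - y ≈⟨ //-rightDividesʳ y z ⟩
    z           ∎

  z≤x-y⇒z+y≤x : ∀ {x y z} → z ≤ x - y → z + y ≤ x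
  z≤x-y⇒z+y≤x {x} {y} {z} p = begin
    z + y       ≤⟨ +-monoˡ-≤ y p ⟩
    (x - y) + y ≈⟨ //-rightDividesˡ y x ⟩
    x           ∎

  z+y≤x⇒z≤x-y : ∀ {x y z} → z + y ≤ x → z ≤ x - y
  z+y≤x⇒z≤x-y {x} {y} {z} p = begin
    z           ≈⟨ //-rightDividesʳ y z ⟨
    (z + y) - y ≤⟨ +-monoˡ-≤ (- y) p ⟩
    x - y       ∎

  +-cancelʳ-≤ : ∀ z {x y} → x + z ≤ y + z → x ≤ y
  +-cancelʳ-≤ z {x} {y} p = ≤-trans (z+y≤x⇒z≤x-y p) (≤-reflexive (//-rightDividesʳ z y))

  +-cancelˡ-≤ : ∀ z {x y} → z + x ≤ z + y → x ≤ y
  +-cancelˡ-≤ z {x} {y} p = +-cancelʳ-≤ z (begin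
    x + z ≈⟨ +-comm x z ⟩
    z + x ≤⟨ p ⟩
    z + y ≈⟨ +-comm z y ⟩
    y + z ∎)

  +-monoˡ-< : ∀ z {x y} → x < y → x + z < y + z
  +-monoˡ-< z x<y = ≰⇒> (<⇒≱ x<y ∘ +-cancelʳ-≤ z)

  0≤y-x : ∀ {x y} → x ≤ y → 0# ≤ y - x
  0≤y-x {x} x≤y = z+y≤x⇒z≤x-y (≤-trans (≤-reflexive (+-identityˡ x)) x≤y)

  0<y-x : ∀ {x y} → x < y → 0# < y - x
  0<y-x {x} {y} x<y = ≰⇒> λ y-x≤0 → <⇒≱ x<y
    (≤-trans (x-y≤z⇒x≤z+y y-x≤0) (≤-reflexive (+-identityˡ x)))

  neg-≤0 : ∀ {x} → 0# ≤ x → - x ≤ 0#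
  neg-≤0 {x} 0≤x = begin
    - x      ≈⟨ +-identityˡ (- x) ⟨
    0# - x   ≤⟨ +-monoˡ-≤ (- x) 0≤x ⟩
    x - x    ≈⟨ -‿inverseʳ x ⟩
    0#       ∎

  neg-≥0 : ∀ {x} → x ≤ 0# → 0# ≤ - x
  neg-≥0 {x} x≤0 = begin
    0#     ≈⟨ -‿inverseʳ x ⟨
    x - x  ≤⟨ +-monoˡ-≤ (- x) x≤0 ⟩
    0# - x ≈⟨ +-identityˡ (- x) ⟩
    - x    ∎

  x≤∣x∣ : ∀ x → x ≤ ∣ x ∣
  x≤∣x∣ x with total 0# x
  ... | inj₁ 0≤x = ≤-refl
  ... | inj₂ x≤0 = ≤-trans x≤0 (neg-≥0 x≤0)

  -x≤∣x∣ : ∀ x → - x ≤ ∣ x ∣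
  -x≤∣x∣ x with total 0# x
  ... | inj₁ 0≤x = ≤-trans (neg-≤0 0≤x) 0≤x
  ... | inj₂ x≤0 = ≤-refl

  ≤∣∣⇒ : ∀ {a} x → a ≤ ∣ x ∣ → a ≤ x ⊎ a ≤ - x
  ≤∣∣⇒ x a≤ with total 0# x
  ... | inj₁ 0≤x = inj₁ a≤
  ... | inj₂ x≤0 = inj₂ a≤

  ∣x-y∣<z⇒x<z+y : ∀ {x y z} → ∣ x - y ∣ < z → x < z + y
  ∣x-y∣<z⇒x<z+y p = ≰⇒> λ z+y≤x → <⇒≱ p (≤-trans (z+y≤x⇒z≤x-y z+y≤x) (x≤∣x∣ _))

  ∣x-y∣<z⇒y<z+x : ∀ {x y z} → ∣ x - y ∣ < z → y < z + x
  ∣x-y∣<z⇒y<z+x {x} {y} p = ≰⇒> λ z+x≤y → <⇒≱ p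
    (≤-trans (≤-trans (z+y≤x⇒z≤x-y z+x≤y) (≤-reflexive (sym (⁻¹-anti-homo‿- x y)))) (-x≤∣x∣ _))

  *-monoˡ-≤ : ∀ {z x y} → 0# ≤ z → x ≤ y → z * x ≤ z * y
  *-monoˡ-≤ {z} {x} {y} 0≤z x≤y = begin
    z * x               ≈⟨ +-identityˡ (z * x) ⟨
    0# + z * x          ≤⟨ z≤x-y⇒z+y≤x (≤-trans (*-nonNegative 0≤z (0≤y-x x≤y)) (≤-reflexive (x[y-z]≈xy-xz z y x))) ⟩
    z * y               ∎

  *-monoʳ-≤ : ∀ {z x y} → 0# ≤ z → x ≤ y → x * z ≤ y * z
  *-monoʳ-≤ {z} {x} {y} 0≤z x≤y = begin
    x * z ≈⟨ *-comm x z ⟩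
    z * x ≤⟨ *-monoˡ-≤ 0≤z x≤y ⟩
    z * y ≈⟨ *-comm z y ⟩
    y * z ∎

  0≤1 : 0# ≤ 1#
  0≤1 with total 0# 1#
  ... | inj₁ 0≤1 = 0≤1
  ... | inj₂ 1≤0 = begin
    -- If 1 were at most 0, then -1 would be nonnegative, and 1 is its square.
    0#             ≤⟨ *-nonNegative (neg-≥0 1≤0) (neg-≥0 1≤0) ⟩
    - 1# * - 1#    ≈⟨ -1*x≈-x (- 1#) ⟩
    - - 1#         ≈⟨ -‿involutive 1# ⟩
    1#             ∎

  0<1 : 0# < 1#
  0<1 = 0≤1 , 0≉1

  fromℕ-nonNegative : ∀ n → 0# ≤ fromℕ n
  fromℕ-nonNegative zero    = ≤-refl
  fromℕ-nonNegative (suc n) =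
    ≤-trans (≤-reflexive (sym (+-identityˡ 0#))) (+-mono-≤ 0≤1 (fromℕ-nonNegative n))

  fromℕ-mono-≤ : ∀ {m n} → m ℕ.≤ n → fromℕ m ≤ fromℕ n
  fromℕ-mono-≤ {n = n} z≤n = fromℕ-nonNegative n
  fromℕ-mono-≤ (s≤s m≤n)   = +-monoʳ-≤ 1# (fromℕ-mono-≤ m≤n)

  fromℕ-cancel-≤ : ∀ m n → fromℕ m ≤ fromℕ n → m ℕ.≤ n
  fromℕ-cancel-≤ zero    n       _ = z≤n
  fromℕ-cancel-≤ (suc m) (suc n) p = s≤s (fromℕ-cancel-≤ m n (+-cancelˡ-≤ 1# p))
  fromℕ-cancel-≤ (suc m) zero    p = contradiction 1≤0 (<⇒≱ 0<1)
    where
    1≤0 : 1# ≤ 0#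
    1≤0 = begin
      1#           ≈⟨ +-identityʳ 1# ⟨
      1# + 0#      ≤⟨ +-monoʳ-≤ 1# (fromℕ-nonNegative m) ⟩
      1# + fromℕ m ≤⟨ p ⟩
      0#           ∎

  0<fromℕ : ∀ n → 0# < fromℕ (suc n)
  0<fromℕ n = ≰⇒> (λ p → ℕ.<⇒≱ (ℕ.z<s {n}) (fromℕ-cancel-≤ (suc n) 0 p))

  fromℕ-* : ∀ m n → fromℕ (m ℕ.* n) ≈ fromℕ m * fromℕ n
  fromℕ-* = ×1-homo-*

  fromℕ-+ : ∀ m n → fromℕ (m ℕ.+ n) ≈ fromℕ m + fromℕ n
  fromℕ-+ = ×-homo-+ 1#

  0<⇒≉0 : ∀ {x} → 0# < x → x ≉ 0#
  0<⇒≉0 (_ , 0≉x) = 0≉x ∘ sym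

  0<x⁻¹ : ∀ {x} → 0# < x → 0# < x ⁻¹
  0<x⁻¹ {x} 0<x@(0≤x , _) = ≰⇒> λ x⁻¹≤0 → <⇒≱ 0<1 (begin
    1#        ≈⟨ *-inverseʳ (0<⇒≉0 0<x) ⟨
    x * x ⁻¹  ≤⟨ *-monoˡ-≤ 0≤x x⁻¹≤0 ⟩
    x * 0#    ≈⟨ zeroʳ x ⟩
    0#        ∎)

  halve : ∀ {x} → 0# < x → ∃[ h ] 0# < h × h + h ≈ x
  halve {x} 0<x@(0≤x , _) = x * ½ , ≰⇒> ½-pos , sum≈
    where
    ½ = fromℕ 2 ⁻¹
    sum≈ : x * ½ + x * ½ ≈ x
    sum≈ = begin-equality
      x * ½ + x * ½         ≈⟨ distribˡ x ½ ½ ⟨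
      x * (½ + ½)           ≈⟨ *-congˡ (+-cong (*-identityˡ ½) (trans (+-identityʳ _) (*-identityˡ ½))) ⟨
      x * (1# * ½ + (1# * ½ + 0#)) ≈⟨ *-congˡ (×-assoc-* 2 1# ½) ⟨
      x * (fromℕ 2 * ½)     ≈⟨ *-congˡ (*-inverseʳ (0<⇒≉0 (0<fromℕ 1))) ⟩
      x * 1#                ≈⟨ *-identityʳ x ⟩
      x                     ∎
    ½-pos : ¬ x * ½ ≤ 0#
    ½-pos p = <⇒≱ 0<x (begin
      x             ≈⟨ sum≈ ⟨
      x * ½ + x * ½ ≤⟨ +-mono-≤ p p ⟩
      0# + 0#       ≈⟨ +-identityʳ 0# ⟩
      0#            ∎)

  -- Limits and consequences of completeness.

  limit-≤ : ∀ {a l b} N → ConvergesTo a l → (∀ n → N ℕ.≤ n → a n ≤ b) → l ≤ b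
  limit-≤ {a} {l} {b} N a→l a≤b = ≮⇒≥ λ b<l →
    -- The tolerance is the whole gap `l - b`: a term that close to `l` would exceed `b`.
    let M , close = a→l (l - b) (0<y-x b<l)
        n = N ℕ.⊔ M
    in <⇒≱ (∣x-y∣<z⇒y<z+x (close n (ℕ.m≤n⊔m N M))) (begin
      (l - b) + a n ≤⟨ +-monoʳ-≤ (l - b) (a≤b n (ℕ.m≤m⊔n N M)) ⟩
      (l - b) + b   ≈⟨ //-rightDividesˡ b l ⟩
      l             ∎)

  ≤-limit : ∀ {a l b} N → ConvergesTo a l → (∀ n → N ℕ.≤ n → b ≤ a n) → b ≤ l
  ≤-limit {a} {l} {b} N a→l b≤a = ≮⇒≥ λ l<b →
    let M , close = a→l (b - l) (0<y-x l<b)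
        n = N ℕ.⊔ M
    in <⇒≱ (∣x-y∣<z⇒x<z+y (close n (ℕ.m≤n⊔m N M))) (begin
      (b - l) + l   ≈⟨ //-rightDividesˡ l b ⟩
      b             ≤⟨ b≤a n (ℕ.m≤m⊔n N M) ⟩
      a n           ∎)

  limit-unique-≤ : ∀ {a l l′} → ConvergesTo a l → ConvergesTo a l′ → l ≤ l′
  limit-unique-≤ {a} {l} {l′} a→l a→l′ = ≮⇒≥ λ l′<l →
    -- A term within half the gap of both limits would yield `l < l`.
    let h , 0<h , h+h≈ = halve (0<y-x l′<l)
        M , close  = a→l h 0<h
        N , close′ = a→l′ h 0<h
        n = M ℕ.⊔ N
    in <⇒≱ (∣x-y∣<z⇒y<z+x (close n (ℕ.m≤m⊔n M N))) (begin
      h + a n        ≤⟨ +-monoʳ-≤ h (proj₁ (∣x-y∣<z⇒x<z+y (close′ n (ℕ.m≤n⊔m M N)))) ⟩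
      h + (h + l′)   ≈⟨ +-assoc h h l′ ⟨
      (h + h) + l′   ≈⟨ +-congʳ h+h≈ ⟩
      (l - l′) + l′  ≈⟨ //-rightDividesˡ l′ l ⟩
      l              ∎)

  -- The supremum of {0} ∪ {1 ∣ P} is at least 1 exactly when P holds.
  excludedMiddle : ∀ (P : Set) → Dec P
  excludedMiddle P with complete (λ x → x ≈ 0# ⊎ (x ≈ 1# × P)) (0# , inj₁ refl)
    (1# , λ { x (inj₁ x≈0)       → ≤-trans (≤-reflexive x≈0) 0≤1
            ; x (inj₂ (x≈1 , _)) → ≤-reflexive x≈1 })
  ... | s , upper , least with 1# ≤? s
  ...   | no 1≰s  = no λ p → 1≰s (upper 1# (inj₂ (refl , p)))
  ...   | yes 1≤s with least 0# (≰⇒> λ s≤0 → <⇒≱ 0<1 (≤-trans 1≤s s≤0))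
  ...     | x , inj₁ x≈0 , 0<x     = contradiction x≈0 (0<⇒≉0 0<x)
  ...     | x , inj₂ (_ , p) , 0<x = yes p

  -- Otherwise the naturals are bounded and have a supremum `s`. As `s - 1` is no upper bound, some
  -- `n` exceeds it, and then `n + 1` exceeds `s`.
  archimedean : ∀ x → ∃[ n ] x ≤ fromℕ n
  archimedean x with excludedMiddle (∃[ n ] x ≤ fromℕ n)
  ... | yes bounded = bounded
  ... | no unbounded with complete (λ y → ∃[ n ] y ≈ fromℕ n) (0# , 0 , refl)
      (x , λ { y (n , y≈n) → ≤-trans (≤-reflexive y≈n) (proj₁ (≰⇒> (unbounded ∘ (n ,_)))) })
  ...   | s , upper , least with least (s - 1#) (≰⇒> λ s≤s-1 → <⇒≱ 0<1 (+-cancelˡ-≤ s (begin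
            s + 1#        ≤⟨ +-monoˡ-≤ 1# s≤s-1 ⟩
            (s - 1#) + 1# ≈⟨ //-rightDividesˡ 1# s ⟩
            s             ≈⟨ +-identityʳ s ⟨
            s + 0#        ∎)))
  ...     | y , (n , y≈n) , s-1<y = contradiction (upper (fromℕ (suc n)) (suc n , refl)) (<⇒≱ (begin-strict
            s             ≈⟨ //-rightDividesˡ 1# s ⟨
            (s - 1#) + 1# <⟨ +-monoˡ-< 1# s-1<y ⟩
            y + 1#        ≈⟨ +-congʳ y≈n ⟩
            fromℕ n + 1#  ≈⟨ +-comm (fromℕ n) 1# ⟩
            fromℕ (suc n) ∎))

  -- Bounds by powers of two are convenient because their products add exponents, which can then be
  -- compared with a logarithm.
  archimedean-2^ : ∀ x → ∃[ k ] x ≤ fromℕ (2 ℕ.^ k)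
  archimedean-2^ x = let n , x≤n = archimedean x in n , ≤-trans x≤n (fromℕ-mono-≤ (n≤2^n n))
    where
    n≤2^n : ∀ n → n ℕ.≤ 2 ℕ.^ n
    n≤2^n zero    = z≤n
    n≤2^n (suc n) = ℕ.+-mono-≤ (ℕ.m^n>0 2 n) (ℕ.≤-trans (n≤2^n n) (ℕ.≤-reflexive (≡.sym (ℕ.+-identityʳ _))))

  -- IsExp ε need not be shown to have a solution: it suffices that all
  -- solutions have a common bound, and they agree if there are any.
  exp-bounded : ∀ ε → ∃[ k ] (∀ y → IsExp ε y → y ≤ fromℕ (2 ℕ.^ k))
  exp-bounded ε with excludedMiddle (∃[ y ] IsExp ε y)
  ... | no none       = 0 , λ y exp → contradiction (y , exp) none
  ... | yes (x , exp) = let k , x≤ = archimedean-2^ x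
                        in k , λ y exp′ → ≤-trans (limit-unique-≤ exp′ exp) x≤

  -- Used for `1 - γ`, and for the gap `a - x i` when a point lies strictly below a threshold `a`.
  reciprocal-bounded : ∀ {x} → 0# < x → ∃[ r ] 1# ≤ fromℕ (2 ℕ.^ r) * x
  reciprocal-bounded {x} 0<x@(0≤x , _) = let r , x⁻¹≤ = archimedean-2^ (x ⁻¹) in r , (begin
    1#                    ≈⟨ *-inverseʳ (0<⇒≉0 0<x) ⟨
    x * x ⁻¹              ≈⟨ *-comm x (x ⁻¹) ⟩
    x ⁻¹ * x              ≤⟨ *-monoʳ-≤ 0≤x x⁻¹≤ ⟩
    fromℕ (2 ℕ.^ r) * x   ∎)

  -- Finite sums and series with nonnegative terms.

  ∑-mono-≤ : ∀ {n} {f g : Fin n → Carrier} → (∀ i → f i ≤ g i) → ∑ f ≤ ∑ g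
  ∑-mono-≤ {zero}  f≤g = ≤-refl
  ∑-mono-≤ {suc n} f≤g = +-mono-≤ (f≤g zero) (∑-mono-≤ (f≤g ∘ suc))

  partialSum-mono : ∀ {a : ℕ → Carrier} → (∀ i → 0# ≤ a i) → ∀ {m n} → m ℕ.≤ n →
                    ∑ (λ (i : Fin m) → a (toℕ i)) ≤ ∑ (λ (i : Fin n) → a (toℕ i))
  partialSum-mono 0≤a {n = zero}  z≤n = ≤-refl
  partialSum-mono 0≤a {n = suc n} z≤n = ≤-trans (≤-reflexive (sym (+-identityˡ 0#)))
    (+-mono-≤ (0≤a 0) (partialSum-mono (0≤a ∘ suc) {n = n} z≤n))
  partialSum-mono 0≤a (s≤s m≤n)       = +-monoʳ-≤ _ (partialSum-mono (0≤a ∘ suc) m≤n)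

  partialSum≤HasSum : ∀ {a s} → (∀ i → 0# ≤ a i) → HasSum a s → ∀ n →
                      ∑ (λ (i : Fin n) → a (toℕ i)) ≤ s
  partialSum≤HasSum 0≤a has n = ≤-limit n has (λ _ → partialSum-mono 0≤a)

-- Finite families of sets as sequences.

module _ {X : Set} where

  -- Continues a finite family with empty sets, giving the countable form that `union` and
  -- `σ-additive` expect.
  pad : ∀ {n} → (Fin n → Pred X 0ℓ) → ℕ → Pred X 0ℓ
  pad {zero}  G k       = ∅
  pad {suc n} G zero    = G zero
  pad {suc n} G (suc k) = pad (G ∘ suc) k

  pad-toℕ : ∀ {n} (G : Fin n → Pred X 0ℓ) i → pad G (toℕ i) ≡ G i
  pad-toℕ G zero    = ≡.refl
  pad-toℕ G (suc i) = pad-toℕ (G ∘ suc) i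

  pad-elim : ∀ {n} (G : Fin n → Pred X 0ℓ) k {x} → pad G k x → ∃[ i ] toℕ i ≡ k × G i x
  pad-elim {suc n} G zero    Gx = zero , ≡.refl , Gx
  pad-elim {suc n} G (suc k) Gx =
    let i , eq , Gix = pad-elim (G ∘ suc) k Gx in suc i , ≡.cong suc eq , Gix

  ⋃-pad : ∀ {n} (G : Fin n → Pred X 0ℓ) → ⋃ ℕ (pad G) ≐ ⋃ (Fin n) G
  ⋃-pad G = (λ (k , Gx) → let i , _ , Gix = pad-elim G k Gx in i , Gix) ,
            (λ {x} (i , Gix) → toℕ i , ≡.subst (λ S → S x) (≡.sym (pad-toℕ G i)) Gix)

  PairwiseDisjoint : ∀ {n} → (Fin n → Pred X 0ℓ) → Set
  PairwiseDisjoint G = ∀ i j → i ≢ j → Empty (G i ∩ G j)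

  pad-disjoint : ∀ {n} (G : Fin n → Pred X 0ℓ) → PairwiseDisjoint G →
                 ∀ j k → j ≢ k → Empty (pad G j ∩ pad G k)
  pad-disjoint G disjoint j k j≢k x (Gj , Gk) with pad-elim G j Gj | pad-elim G k Gk
  ... | i , ≡.refl , Gix | i′ , ≡.refl , Gi′x = disjoint i i′ (j≢k ∘ ≡.cong toℕ) x (Gix , Gi′x)

  pair : Pred X 0ℓ → Pred X 0ℓ → Fin 2 → Pred X 0ℓ
  pair A B zero       = A
  pair A B (suc zero) = B

-- Borel sets and finite additivity.

module Measure (ℝ : CompleteOrderedField) where
  open CompleteOrderedField ℝ hiding (zero)
  open Probability ℝ
  open OrderedField ℝ
  open ≤-Reasoning

  module _ {n : ℕ} where

    pad-borel : ∀ {m} {G : Fin m → Pred (Vector Carrier n) 0ℓ} →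
                (∀ i → Borel (G i)) → ∀ k → Borel (pad G k)
    pad-borel {zero}  borel k       = empty
    pad-borel {suc m} borel zero    = borel zero
    pad-borel {suc m} borel (suc k) = pad-borel (borel ∘ suc) k

    ⋃-borel : ∀ {m} {G : Fin m → Pred (Vector Carrier n) 0ℓ} →
              (∀ i → Borel (G i)) → Borel (⋃ (Fin m) G)
    ⋃-borel {G = G} borel = resp (⋃-pad G) (union (pad-borel borel))

    pair-borel : ∀ {A B : Pred (Vector Carrier n) 0ℓ} → Borel A → Borel B → ∀ i → Borel (pair A B i)
    pair-borel borelA borelB zero       = borelA
    pair-borel borelA borelB (suc zero) = borelB

    -- { a ≤ xᵢ } is the complement of the union over k of { xᵢ ≤ a - 2⁻ᵏ }.
    upperHalfSpace : ∀ i a → Borel {n} (λ x → a ≤ x i)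
    upperHalfSpace i a = resp ((λ {x} → to {x}) , λ {x} → from {x}) (complement (union (λ k → halfSpace i (a - δ k))))
      where
      δ : ℕ → Carrier
      δ k = fromℕ (2 ℕ.^ k) ⁻¹
      0<2^ : ∀ k → 0# < fromℕ (2 ℕ.^ k)
      0<2^ k with 2 ℕ.^ k | ℕ.m^n>0 2 k
      ... | suc m | _ = 0<fromℕ m
      to : ∀ {x : Vector Carrier n} → ¬ (∃[ k ] x i ≤ a - δ k) → a ≤ x i
      to {x} none = ≮⇒≥ λ xi<a →
        let r , 1≤ = reciprocal-bounded (0<y-x xi<a)
            0≤δ , _ = 0<x⁻¹ (0<2^ r)
        in none (r , z+y≤x⇒z≤x-y (begin
          x i + δ r                                 ≈⟨ +-comm (x i) (δ r) ⟩
          δ r + x i                                 ≈⟨ +-congʳ (*-identityʳ (δ r)) ⟨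
          δ r * 1# + x i                            ≤⟨ +-monoˡ-≤ (x i) (*-monoˡ-≤ 0≤δ 1≤) ⟩
          δ r * (fromℕ (2 ℕ.^ r) * (a - x i)) + x i ≈⟨ +-congʳ (*-assoc _ _ _) ⟨
          δ r * fromℕ (2 ℕ.^ r) * (a - x i) + x i   ≈⟨ +-congʳ (*-congʳ (trans (*-comm _ _) (*-inverseʳ (0<⇒≉0 (0<2^ r))))) ⟩
          1# * (a - x i) + x i                      ≈⟨ +-congʳ (*-identityˡ _) ⟩
          (a - x i) + x i                           ≤⟨ z≤x-y⇒z+y≤x ≤-refl ⟩
          a                                         ∎))
      from : ∀ {x : Vector Carrier n} → a ≤ x i → ¬ (∃[ k ] x i ≤ a - δ k)
      from {x} a≤xi (k , xi≤) = <⇒≱ (0<x⁻¹ (0<2^ k)) (+-cancelʳ-≤ a (begin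
        δ k + a  ≈⟨ +-comm (δ k) a ⟩
        a + δ k  ≤⟨ z≤x-y⇒z+y≤x (≤-trans a≤xi xi≤) ⟩
        a        ≈⟨ +-identityˡ a ⟨
        0# + a   ∎))

    -- The event is the union of the half-spaces `a + m ≤ x i` and `x i ≤ m - a`.
    deviation-borel : ∀ i a m → Borel {n} (λ x → a ≤ ∣ x i - m ∣)
    deviation-borel i a m =
      resp (to , from) (⋃-borel (pair-borel (upperHalfSpace i (a + m)) (halfSpace i (m - a))))
      where
      open Algebra.Properties.Ring ring using (⁻¹-anti-homo‿-)
      sides : Fin 2 → Pred (Vector Carrier n) 0ℓ
      sides = pair (λ x → a + m ≤ x i) (λ x → x i ≤ m - a)
      to : ∀ {x} → ⋃ (Fin 2) sides x → a ≤ ∣ x i - m ∣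
      to {x} (zero , a+m≤x)     = ≤-trans (z+y≤x⇒z≤x-y a+m≤x) (x≤∣x∣ _)
      to {x} (suc zero , x≤m-a) = begin
        a             ≤⟨ z+y≤x⇒z≤x-y (≤-trans (≤-reflexive (+-comm a (x i))) (z≤x-y⇒z+y≤x x≤m-a)) ⟩
        m - x i       ≈⟨ ⁻¹-anti-homo‿- (x i) m ⟨
        - (x i - m)   ≤⟨ -x≤∣x∣ _ ⟩
        ∣ x i - m ∣   ∎
      from : ∀ {x} → a ≤ ∣ x i - m ∣ → ⋃ (Fin 2) sides x
      from {x} p with ≤∣∣⇒ (x i - m) p
      ... | inj₁ a≤x-m = zero , z≤x-y⇒z+y≤x a≤x-m
      ... | inj₂ a≤-   = suc zero , z+y≤x⇒z≤x-y (begin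
        x i + a  ≈⟨ +-comm (x i) a ⟩
        a + x i  ≤⟨ z≤x-y⇒z+y≤x (≤-trans a≤- (≤-reflexive (⁻¹-anti-homo‿- (x i) m))) ⟩
        m        ∎)

    module _ (μ : ProbabilityMeasure n) where

      -- Countable additivity for the sequence of empty sets: its first two terms already give
      -- `p + p ≤ p` for `p = Pr μ ∅`.
      Pr-∅ : Pr μ ∅ ≤ 0#
      Pr-∅ = +-cancelˡ-≤ (Pr μ ∅) (begin
        Pr μ ∅ + Pr μ ∅        ≈⟨ +-congˡ (+-identityʳ (Pr μ ∅)) ⟨
        Pr μ ∅ + (Pr μ ∅ + 0#) ≤⟨ partialSum≤HasSum (λ _ → nonNegative μ empty)
                                    (σ-additive μ (λ _ → ∅) (λ _ → empty) (λ { _ _ _ _ () })) 2 ⟩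
        Pr μ (⋃ ℕ (λ _ → ∅))   ≈⟨ Pr-cong μ (union (λ _ → empty)) ((λ { () }) , λ ()) ⟩
        Pr μ ∅                 ≈⟨ +-identityʳ (Pr μ ∅) ⟨
        Pr μ ∅ + 0#            ∎)

      module _ {m} {G : Fin m → Pred (Vector Carrier n) 0ℓ}
               (borel : ∀ i → Borel (G i)) (disjoint : PairwiseDisjoint G) where

        private
          hasSum : HasSum (λ k → Pr μ (pad G k)) (Pr μ (⋃ ℕ (pad G)))
          hasSum = σ-additive μ (pad G) (pad-borel borel) (pad-disjoint G disjoint)

          Pr-⋃-pad : Pr μ (⋃ ℕ (pad G)) ≈ Pr μ (⋃ (Fin m) G)
          Pr-⋃-pad = Pr-cong μ (union (pad-borel borel)) (⋃-pad G)

        -- The left side is a partial sum of the nonnegative series of the padded family.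
        ∑-Pr≤Pr-⋃ : ∑ (λ i → Pr μ (G i)) ≤ Pr μ (⋃ (Fin m) G)
        ∑-Pr≤Pr-⋃ = begin
          ∑ (λ i → Pr μ (G i))
            ≤⟨ ∑-mono-≤ (λ i → ≤-reflexive (reflexive (≡.cong (Pr μ) (≡.sym (pad-toℕ G i))))) ⟩
          ∑ (λ (i : Fin m) → Pr μ (pad G (toℕ i)))
            ≤⟨ partialSum≤HasSum (nonNegative μ ∘ pad-borel borel) hasSum m ⟩
          Pr μ (⋃ ℕ (pad G))
            ≈⟨ Pr-⋃-pad ⟩
          Pr μ (⋃ (Fin m) G) ∎

        -- From index `m` on, the padded family contributes only `Pr μ ∅ ≤ 0`, so no later partial
        -- sum exceeds the finite sum, and neither does the limit.
        Pr-⋃≤∑-Pr : Pr μ (⋃ (Fin m) G) ≤ ∑ (λ i → Pr μ (G i))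
        Pr-⋃≤∑-Pr = ≤-trans (≤-reflexive (sym Pr-⋃-pad)) (limit-≤ m hasSum (λ N → partial G {N}))
          where
          partial : ∀ {m} (G : Fin m → Pred (Vector Carrier n) 0ℓ) {N} → m ℕ.≤ N →
                    ∑ (λ (i : Fin N) → Pr μ (pad G (toℕ i))) ≤ ∑ (λ i → Pr μ (G i))
          partial {zero} G {zero} z≤n  = ≤-refl
          partial {zero} G {suc N} z≤n = begin
            Pr μ ∅ + ∑ (λ (i : Fin N) → Pr μ ∅) ≤⟨ +-mono-≤ Pr-∅ (partial {zero} (λ ()) {N} z≤n) ⟩
            0# + 0#                             ≈⟨ +-identityʳ 0# ⟩
            0#                                  ∎
          partial {suc m} G (s≤s m≤N) = +-monoʳ-≤ _ (partial (G ∘ suc) m≤N)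

      module _ {S : Pred (Vector Carrier n) 0ℓ} (borel : Borel S) where

        private
          both : Fin 2 → Pred (Vector Carrier n) 0ℓ
          both = pair S (∁ S)

          both-borel : ∀ i → Borel (both i)
          both-borel = pair-borel borel (complement borel)

          both-disjoint : PairwiseDisjoint both
          both-disjoint zero       zero       i≢i = contradiction ≡.refl i≢i
          both-disjoint zero       (suc zero) _   = λ x (Sx , ¬Sx) → ¬Sx Sx
          both-disjoint (suc zero) zero       _   = λ x (¬Sx , Sx) → ¬Sx Sx
          both-disjoint (suc zero) (suc zero) i≢i = contradiction ≡.refl i≢i

          Pr-both : Pr μ (⋃ (Fin 2) both) ≈ 1#
          Pr-both = trans (Pr-cong μ (⋃-borel both-borel) ((λ _ → tt) , λ {x} _ → decide x)) (normalised μ)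
            where
            -- That a set and its complement exhaust the space is classical; `excludedMiddle` comes
            -- from completeness.
            decide : ∀ x → ⋃ (Fin 2) both x
            decide x with excludedMiddle (S x)
            ... | yes Sx = zero , Sx
            ... | no ¬Sx = suc zero , ¬Sx

        1≤Pr+Pr-∁ : 1# ≤ Pr μ S + Pr μ (∁ S)
        1≤Pr+Pr-∁ = begin
          1#                         ≈⟨ Pr-both ⟨
          Pr μ (⋃ (Fin 2) both)      ≤⟨ Pr-⋃≤∑-Pr both-borel both-disjoint ⟩
          Pr μ S + (Pr μ (∁ S) + 0#) ≈⟨ +-congˡ (+-identityʳ _) ⟩
          Pr μ S + Pr μ (∁ S)        ∎

        Pr≤1 : Pr μ S ≤ 1#
        Pr≤1 = begin
          Pr μ S                     ≈⟨ +-identityʳ _ ⟨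
          Pr μ S + 0#                ≤⟨ +-monoʳ-≤ _ (nonNegative μ (complement borel)) ⟩
          Pr μ S + Pr μ (∁ S)        ≈⟨ +-congˡ (+-identityʳ _) ⟨
          Pr μ S + (Pr μ (∁ S) + 0#) ≤⟨ ∑-Pr≤Pr-⋃ both-borel both-disjoint ⟩
          Pr μ (⋃ (Fin 2) both)      ≈⟨ Pr-both ⟩
          1#                         ∎

-- Group privacy and the packing bound.

module LowerBound (ℝ : CompleteOrderedField) where
  open CompleteOrderedField ℝ hiding (zero)
  open Probability ℝ
  open Privacy ℝ
  open OrderedField ℝ
  open Measure ℝ
  open ≤-Reasoning

  -- Once the minimum cut weight at each step is fixed, the event is a finite union of deviation
  -- events over the time steps.
  errorAtLeast-borel : ∀ {W T} (𝒢 : IncrementalSequence W T) α →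
    (∀ t → ∃[ m ] IsMinCutWeight (graph 𝒢 (suc t)) m) → Borel (ErrorAtLeast 𝒢 α)
  errorAtLeast-borel 𝒢 α minCut = resp (to , from)
    (⋃-borel (λ t → deviation-borel t α (fromℕ (proj₁ (minCut t)))))
    where
    to : ∀ {x} → (∃[ t ] α ≤ ∣ x t - fromℕ (proj₁ (minCut t)) ∣) → ErrorAtLeast 𝒢 α x
    to (t , far) = t , proj₁ (minCut t) , proj₂ (minCut t) , far
    from : ∀ {x} → ErrorAtLeast 𝒢 α x → ∃[ t ] α ≤ ∣ x t - fromℕ (proj₁ (minCut t)) ∣
    from {x} (t , m , isMin , far) = t , ≡.subst (λ m → α ≤ ∣ x t - fromℕ m ∣)
      (minCut-unique {G = graph 𝒢 (suc t)} isMin (proj₂ (minCut t))) far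

  -- Every link of the chain of adjacent inputs costs a factor `e^ε`. Replacing it by an integer
  -- bound `K` lets the final comparison take place in `ℕ`.
  groupPrivacy : ∀ {W T ε} {A : Algorithm W T} K → (∀ y → IsExp ε y → y ≤ fromℕ K) →
    ε -NodeDifferentiallyPrivate A → ∀ (𝒢 : ℕ → IncrementalSequence W T) →
    (∀ j → NodeAdjacent (𝒢 (suc j)) (𝒢 j)) → ∀ {S} → Borel S →
    ∀ j → Pr (output A (𝒢 j)) S ≤ fromℕ (K ℕ.^ j) * Pr (output A (𝒢 0)) S
  groupPrivacy K bound _ 𝒢 adjacent borel zero =
    ≤-reflexive (sym (trans (*-congʳ (+-identityʳ 1#)) (*-identityˡ _)))
  groupPrivacy {A = A} K bound dp@(e^ε , exp , dp-step) 𝒢 adjacent {S} borel (suc j) = begin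
    P (suc j)                         ≤⟨ dp-step _ _ (adjacent j) S borel ⟩
    e^ε * P j                         ≤⟨ *-monoʳ-≤ (nonNegative (output A (𝒢 j)) borel) (bound e^ε exp) ⟩
    fromℕ K * P j                     ≤⟨ *-monoˡ-≤ (fromℕ-nonNegative K)
                                           (groupPrivacy {A = A} K bound dp 𝒢 adjacent borel j) ⟩
    fromℕ K * (fromℕ (K ℕ.^ j) * P 0) ≈⟨ *-assoc _ _ _ ⟨
    fromℕ K * fromℕ (K ℕ.^ j) * P 0   ≈⟨ *-congʳ (fromℕ-* K (K ℕ.^ j)) ⟨
    fromℕ (K ℕ.^ suc j) * P 0         ∎
    where
    P : ℕ → Carrier
    P j = Pr (output A (𝒢 j)) S

  fromℕ≤*∑ : ∀ {n} x (p : Fin n → Carrier) → (∀ i → 1# ≤ x * p i) → fromℕ n ≤ x * ∑ p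
  fromℕ≤*∑ {zero}  x p _  = ≤-reflexive (sym (zeroʳ x))
  fromℕ≤*∑ {suc n} x p 1≤ = begin
    1# + fromℕ n                       ≤⟨ +-mono-≤ (1≤ zero) (fromℕ≤*∑ x (p ∘ suc) (1≤ ∘ suc)) ⟩
    x * p zero + x * ∑ (p ∘ suc)       ≈⟨ distribˡ x _ _ ⟨
    x * (p zero + ∑ (p ∘ suc))         ∎

  module _ {W T d : ℕ} {α : Carrier} (2α≤dW : α + α ≤ fromℕ (d ℕ.* W)) where

    -- Excluding errors of at least `α` leaves strict bounds, so the events are disjoint even when
    -- `2α` equals `dW`.
    Accurate : Fin T → Pred (Vector Carrier T) 0ℓ
    Accurate t = ∁ (ErrorAtLeast (jumpSequence {W} t d) α)

    error-borel : ∀ t → Borel (ErrorAtLeast (jumpSequence {W} {T} t d) α)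
    error-borel t = errorAtLeast-borel (jumpSequence t d) α (jumpSequence-minCut t d ∘ suc)

    accurate-borel : ∀ t → Borel (Accurate t)
    accurate-borel t = complement (error-borel t)

    -- Right after the earlier jump the minimum cuts differ by dW ≥ 2α.
    accurate-disjoint-< : ∀ {s t} → toℕ s ℕ.< toℕ t → Empty (Accurate s ∩ Accurate t)
    accurate-disjoint-< {s} {t} s<t x (accurate-s , accurate-t) = <⇒≱ far (+-monoˡ-≤ (fromℕ W) 2α≤dW)
      where
      close-s : ∣ x s - fromℕ (suc d ℕ.* W) ∣ < α
      close-s = ≰⇒> λ α≤ → accurate-s (s , _ , jumpSequence-after s d (suc s) ℕ.≤-refl , α≤)
      close-t : ∣ x s - fromℕ W ∣ < α
      close-t = ≰⇒> λ α≤ → accurate-t (s , _ , jumpSequence-before t d (suc s) s<t , α≤)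
      far : fromℕ (d ℕ.* W) + fromℕ W < (α + α) + fromℕ W
      far = begin-strict
        fromℕ (d ℕ.* W) + fromℕ W ≈⟨ +-comm _ _ ⟩
        fromℕ W + fromℕ (d ℕ.* W) ≈⟨ fromℕ-+ W (d ℕ.* W) ⟨
        fromℕ (suc d ℕ.* W)       <⟨ ∣x-y∣<z⇒y<z+x close-s ⟩
        α + x s                   ≤⟨ +-monoʳ-≤ α (proj₁ (∣x-y∣<z⇒x<z+y close-t)) ⟩
        α + (α + fromℕ W)         ≈⟨ +-assoc α α (fromℕ W) ⟨
        (α + α) + fromℕ W         ∎

    accurate-disjoint : PairwiseDisjoint Accurate
    accurate-disjoint s t s≢t x (as , at) with ℕ.<-cmp (toℕ s) (toℕ t)
    ... | tri< s<t _ _ = accurate-disjoint-< s<t x (as , at)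
    ... | tri≈ _ s≡t _ = s≢t (Fin.toℕ-injective s≡t)
    ... | tri> _ _ t<s = accurate-disjoint-< t<s x (at , as)

    -- On the constant input each of the `T` accuracy events has probability at least `1 / (R K^d)`;
    -- being disjoint, they have total probability at most 1.
    packing : ∀ {ε γ} (A : Algorithm W T) K R → (∀ y → IsExp ε y → y ≤ fromℕ K) →
      1# ≤ fromℕ R * (1# - γ) → ε -NodeDifferentiallyPrivate A →
      (∀ t → Pr (output A (jumpSequence t d)) (ErrorAtLeast (jumpSequence t d) α) ≤ γ) →
      T ℕ.≤ R ℕ.* K ℕ.^ d
    packing {ε} {γ} A K R bound 1≤ dp error≤ = fromℕ-cancel-≤ T (R ℕ.* K ℕ.^ d) (begin
      fromℕ T                     ≤⟨ fromℕ≤*∑ N p likely ⟩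
      N * ∑ p                     ≤⟨ *-monoˡ-≤ (fromℕ-nonNegative (R ℕ.* K ℕ.^ d)) ∑p≤1 ⟩
      N * 1#                      ≈⟨ *-identityʳ N ⟩
      N                           ∎)
      where
      -- One measure serves all `t`, since `jumpSequence t 0` is the constant sequence whatever `t`
      -- is.
      μ₀ = output A (constantSequence {W} {T})
      N = fromℕ (R ℕ.* K ℕ.^ d)
      p : Fin T → Carrier
      p t = Pr μ₀ (Accurate t)
      ∑p≤1 : ∑ p ≤ 1#
      ∑p≤1 = ≤-trans (∑-Pr≤Pr-⋃ μ₀ accurate-borel accurate-disjoint) (Pr≤1 μ₀ (⋃-borel accurate-borel))
      likely : ∀ t → 1# ≤ N * p t
      likely t = begin
        1#                                  ≤⟨ 1≤ ⟩
        -- The error event has probability at most `γ`, so its complement has at least `1 - γ`.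
        fromℕ R * (1# - γ)                  ≤⟨ *-monoˡ-≤ (fromℕ-nonNegative R) (x≤z+y⇒x-y≤z (begin
          1#                                  ≤⟨ 1≤Pr+Pr-∁ μ (error-borel t) ⟩
          Pr μ (ErrorAtLeast 𝒢 α) + Pr μ (Accurate t) ≈⟨ +-comm _ _ ⟩
          Pr μ (Accurate t) + Pr μ (ErrorAtLeast 𝒢 α) ≤⟨ +-monoʳ-≤ _ (error≤ t) ⟩
          Pr μ (Accurate t) + γ               ∎)) ⟩
        fromℕ R * Pr μ (Accurate t)         ≤⟨ *-monoˡ-≤ (fromℕ-nonNegative R)
                                                 (groupPrivacy {A = A} K bound dp (jumpSequence t)
                                                   (jumpSequence-adjacent t) (accurate-borel t) d) ⟩
        fromℕ R * (fromℕ (K ℕ.^ d) * p t)   ≈⟨ *-assoc _ _ _ ⟨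
        fromℕ R * fromℕ (K ℕ.^ d) * p t     ≈⟨ *-congʳ (fromℕ-* R (K ℕ.^ d)) ⟨
        N * p t                             ∎
        where
        𝒢 = jumpSequence {W} t d
        μ = output A 𝒢

-- Binary logarithms and the size of the jump.

2^⌊log₂n⌋≤n : ∀ n → 1 ℕ.≤ n → 2 ℕ.^ ⌊log₂ n ⌋ ℕ.≤ n
2^⌊log₂n⌋≤n n 1≤n = go ⌊log₂ n ⌋ n ≡.refl 1≤n
  where
  open ℕ.≤-Reasoning
  -- Recursion is on the value `l` of the logarithm, which drops by one when `n` is halved.
  go : ∀ l n → ⌊log₂ n ⌋ ≡ l → 1 ℕ.≤ n → 2 ℕ.^ l ℕ.≤ n
  go zero    n             _  1≤n = 1≤n
  go (suc l) (suc (suc n)) eq _   = begin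
    2 ℕ.* 2 ℕ.^ l          ≤⟨ ℕ.*-monoʳ-≤ 2 (go l (suc ℕ.⌊ n /2⌋)
                                (≡.trans (⌊log₂⌊n/2⌋⌋≡⌊log₂n⌋∸1 (2 ℕ.+ n)) (≡.cong ℕ.pred eq)) (s≤s z≤n)) ⟩
    2 ℕ.* ℕ.⌊ 2 ℕ.+ n /2⌋  ≡⟨ ≡.cong (h ℕ.+_) (ℕ.+-identityʳ h) ⟩
    h ℕ.+ h                ≤⟨ ℕ.+-monoʳ-≤ h (ℕ.⌊n/2⌋≤⌈n/2⌉ (2 ℕ.+ n)) ⟩
    h ℕ.+ ℕ.⌈ 2 ℕ.+ n /2⌉  ≡⟨ ℕ.⌊n/2⌋+⌈n/2⌉≡n (2 ℕ.+ n) ⟩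
    2 ℕ.+ n                ∎
    where h = ℕ.⌊ 2 ℕ.+ n /2⌋

-- d = ⌊L / 2k⌋: the privacy loss over d insertions is 2^(kd), and 2^r makes
-- up for the probability 1 - γ of being accurate.
jumpSize : ∀ k r L .{{_ : ℕ.NonZero k}} → 2 ℕ.* k ℕ.+ 2 ℕ.* suc r ℕ.≤ L →
           ∃[ d ] L ℕ.≤ 4 ℕ.* k ℕ.* d × r ℕ.+ k ℕ.* d ℕ.< L
jumpSize k r L large = d , L≤ , ℕ.*-cancelˡ-< 2 _ _ <L
  where
  open ℕ.≤-Reasoning
  instance
    2k≢0 : ℕ.NonZero (2 ℕ.* k)
    2k≢0 = ℕ.m*n≢0 2 k
  d = L ℕ./ (2 ℕ.* k)
  1≤d : 1 ℕ.≤ d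
  1≤d = ℕ.m≥n⇒m/n>0 (ℕ.m+n≤o⇒m≤o (2 ℕ.* k) large)
  2kd≤L : 2 ℕ.* k ℕ.* d ℕ.≤ L
  2kd≤L = ℕ.≤-trans (ℕ.≤-reflexive (ℕ.*-comm (2 ℕ.* k) d)) (ℕ.m/n*n≤m L (2 ℕ.* k))
  L≤ : L ℕ.≤ 4 ℕ.* k ℕ.* d
  L≤ = begin
    L                                       ≡⟨ ℕ.m≡m%n+[m/n]*n L (2 ℕ.* k) ⟩
    L ℕ.% (2 ℕ.* k) ℕ.+ d ℕ.* (2 ℕ.* k)     ≤⟨ ℕ.+-monoˡ-≤ _ (ℕ.<⇒≤ (ℕ.m%n<n L (2 ℕ.* k))) ⟩
    2 ℕ.* k ℕ.+ d ℕ.* (2 ℕ.* k)             ≤⟨ ℕ.+-monoˡ-≤ _ (ℕ.m≤n*m (2 ℕ.* k) d {{ℕ.>-nonZero 1≤d}}) ⟩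
    d ℕ.* (2 ℕ.* k) ℕ.+ d ℕ.* (2 ℕ.* k)     ≡⟨ solve 2 (λ d k → d :* (con 2 :* k) :+ d :* (con 2 :* k) := con 4 :* k :* d) ≡.refl d k ⟩
    4 ℕ.* k ℕ.* d                           ∎
  <L : 2 ℕ.* (r ℕ.+ k ℕ.* d) ℕ.< 2 ℕ.* L
  <L = begin-strict
    2 ℕ.* (r ℕ.+ k ℕ.* d)                   ≡⟨ solve 3 (λ r k d → con 2 :* (r :+ k :* d) := con 2 :* r :+ con 2 :* k :* d) ≡.refl r k d ⟩
    2 ℕ.* r ℕ.+ 2 ℕ.* k ℕ.* d               <⟨ ℕ.+-mono-<-≤ (ℕ.*-monoʳ-< 2 (ℕ.n<1+n r)) 2kd≤L ⟩
    2 ℕ.* suc r ℕ.+ L                       ≤⟨ ℕ.+-monoˡ-≤ L (ℕ.m+n≤o⇒n≤o (2 ℕ.* k) large) ⟩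
    L ℕ.+ L                                 ≡⟨ ≡.cong (L ℕ.+_) (≡.sym (ℕ.+-identityʳ L)) ⟩
    2 ℕ.* L                                 ∎

-- The lower bound with its constants.

theorem34 : (ℝ : CompleteOrderedField) →
  let open CompleteOrderedField ℝ
      open Probability ℝ
      open Privacy ℝ
  in
  ∀ (ε γ : Carrier) → 0# < ε → γ < 1# →
  ∃[ c ] 0# < c × ∃[ T₀ ]
    (∀ (T : ℕ) → T₀ ℕ.≤ T → ∀ (W : ℕ) → 1 ℕ.≤ W →
     ∀ (A : Algorithm W T) → ε -NodeDifferentiallyPrivate A →
     ∃[ 𝒢 ] γ < Pr (output A 𝒢) (ErrorAtLeast 𝒢 (c * fromℕ (W ℕ.* ⌊log₂ T ⌋))))
theorem34 ℝ ε γ 0<ε γ<1 = c , 0<c , T₀ , large-error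
  where
  open CompleteOrderedField ℝ hiding (zero)
  open Probability ℝ
  open Privacy ℝ
  open OrderedField ℝ
  open LowerBound ℝ

  k r T₀ : ℕ
  -- The successor makes `k` positive, so that `2k` can be divided by and `8k` inverted.
  k = suc (proj₁ (exp-bounded ε))
  r = proj₁ (reciprocal-bounded (0<y-x γ<1))
  -- In the exponent, `2k` forces `d ≥ 1`, and `2(r + 1)` leaves room for the factor `2^r` strictly
  -- below `T`.
  T₀ = 2 ℕ.^ (2 ℕ.* k ℕ.+ 2 ℕ.* suc r)

  exp≤ : ∀ y → IsExp ε y → y ≤ fromℕ (2 ℕ.^ k)
  exp≤ y exp = ≤-trans (proj₂ (exp-bounded ε) y exp)
    (fromℕ-mono-≤ (ℕ.^-monoʳ-≤ 2 (ℕ.n≤1+n (proj₁ (exp-bounded ε)))))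

  0<8k : 0# < fromℕ (8 ℕ.* k)
  0<8k = 0<fromℕ (ℕ.pred (8 ℕ.* k))

  c : Carrier
  -- Disjointness asks for `α ≤ dW / 2`, and `d` is at least `L / 4k` for `L` the logarithm of `T`;
  -- hence the factor `1 / 8k`.
  c = fromℕ (8 ℕ.* k) ⁻¹

  0<c : 0# < c
  0<c = 0<x⁻¹ 0<8k

  large-error : ∀ T → T₀ ℕ.≤ T → ∀ W → 1 ℕ.≤ W → ∀ (A : Algorithm W T) →
    ε -NodeDifferentiallyPrivate A →
    ∃[ 𝒢 ] γ < Pr (output A 𝒢) (ErrorAtLeast 𝒢 (c * fromℕ (W ℕ.* ⌊log₂ T ⌋)))
  -- Either some jump input already has the large error probability, or all stay at most `γ` and the
  -- packing bound contradicts the size of `T`.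
  large-error T T₀≤T W _ A dp = search (excludedMiddle (∃[ t ] γ < errorProbability t))
    where
    L = ⌊log₂ T ⌋
    α = c * fromℕ (W ℕ.* L)

    L-large : 2 ℕ.* k ℕ.+ 2 ℕ.* suc r ℕ.≤ L
    L-large = ≡.subst (ℕ._≤ L) (⌊log₂[2^n]⌋≡n (2 ℕ.* k ℕ.+ 2 ℕ.* suc r)) (⌊log₂⌋-mono-≤ T₀≤T)

    size : ∃[ d ] L ℕ.≤ 4 ℕ.* k ℕ.* d × r ℕ.+ k ℕ.* d ℕ.< L
    size = jumpSize k r L L-large

    d : ℕ
    d = proj₁ size

    errorProbability : Fin T → Carrier
    errorProbability t = Pr (output A (jumpSequence t d)) (ErrorAtLeast (jumpSequence t d) α)

    2WL≤ : W ℕ.* L ℕ.+ W ℕ.* L ℕ.≤ 8 ℕ.* k ℕ.* (d ℕ.* W)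
    2WL≤ = begin
      W ℕ.* L ℕ.+ W ℕ.* L ≤⟨ ℕ.+-mono-≤ WL≤ WL≤ ⟩
      W ℕ.* (4 ℕ.* k ℕ.* d) ℕ.+ W ℕ.* (4 ℕ.* k ℕ.* d)
        ≡⟨ solve 3 (λ W k d → W :* (con 4 :* k :* d) :+ W :* (con 4 :* k :* d) := con 8 :* k :* (d :* W)) ≡.refl W k d ⟩
      8 ℕ.* k ℕ.* (d ℕ.* W) ∎
      where
      open ℕ.≤-Reasoning
      WL≤ = ℕ.*-monoʳ-≤ W (proj₁ (proj₂ size))

    2α≤dW : α + α ≤ fromℕ (d ℕ.* W)
    2α≤dW = begin
      α + α                                        ≈⟨ distribˡ c _ _ ⟨
      c * (fromℕ (W ℕ.* L) + fromℕ (W ℕ.* L))      ≈⟨ *-congˡ (fromℕ-+ (W ℕ.* L) (W ℕ.* L)) ⟨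
      c * fromℕ (W ℕ.* L ℕ.+ W ℕ.* L)              ≤⟨ *-monoˡ-≤ (proj₁ 0<c) (fromℕ-mono-≤ 2WL≤) ⟩
      c * fromℕ (8 ℕ.* k ℕ.* (d ℕ.* W))            ≈⟨ *-congˡ (fromℕ-* (8 ℕ.* k) (d ℕ.* W)) ⟩
      c * (fromℕ (8 ℕ.* k) * fromℕ (d ℕ.* W))      ≈⟨ *-assoc _ _ _ ⟨
      c * fromℕ (8 ℕ.* k) * fromℕ (d ℕ.* W)        ≈⟨ *-congʳ (trans (*-comm _ _) (*-inverseʳ (0<⇒≉0 0<8k))) ⟩
      1# * fromℕ (d ℕ.* W)                         ≈⟨ *-identityˡ _ ⟩
      fromℕ (d ℕ.* W)                              ∎
      where open ≤-Reasoning

    -- The left side is the packing bound for `R = 2^r` and `K = 2^k`.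
    T-large : 2 ℕ.^ r ℕ.* (2 ℕ.^ k) ℕ.^ d ℕ.< T
    T-large = begin-strict
      2 ℕ.^ r ℕ.* (2 ℕ.^ k) ℕ.^ d   ≡⟨ ≡.cong (2 ℕ.^ r ℕ.*_) (ℕ.^-*-assoc 2 k d) ⟩
      2 ℕ.^ r ℕ.* 2 ℕ.^ (k ℕ.* d)   ≡⟨ ℕ.^-distribˡ-+-* 2 r (k ℕ.* d) ⟨
      2 ℕ.^ (r ℕ.+ k ℕ.* d)         <⟨ ℕ.^-monoʳ-< 2 ℕ.≤-refl (proj₂ (proj₂ size)) ⟩
      2 ℕ.^ L                       ≤⟨ 2^⌊log₂n⌋≤n T (ℕ.≤-trans (ℕ.m^n>0 2 (2 ℕ.* k ℕ.+ 2 ℕ.* suc r)) T₀≤T) ⟩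
      T                             ∎
      where open ℕ.≤-Reasoning

    search : Dec (∃[ t ] γ < errorProbability t) → ∃[ 𝒢 ] γ < Pr (output A 𝒢) (ErrorAtLeast 𝒢 α)
    search (yes (t , large)) = jumpSequence t d , large
    search (no none)         = contradiction
      (packing {W} {T} {d} 2α≤dW A (2 ℕ.^ k) (2 ℕ.^ r) exp≤ (proj₂ (reciprocal-bounded (0<y-x γ<1))) dp
        (λ t → ≮⇒≥ (none ∘ (t ,_))))
      (ℕ.<⇒≱ T-large)
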